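{- There is a $4$-pass catalytic streaming algorithm that computes $F_0(\mathcal S)=|\{i\in[n]: f_i\neq 0\}|$ exactly, using $O(\log m)$ clean space and $O(m\cdot n)$ catalytic space.
   Context: A stream is a sequence $\mathcal S=\langle x_1,\dots,x_m\rangle$ with $x_i\in[n]=\{1,\dots,n\}$ (insertion-only); $f_i$ is the number of occurrences of $i$ in the stream, so $F_0(\mathcal S)$ is the number of distinct elements. The length $m$ is known to the algorithm in advance and $m\ge n$. Catalytic streaming model: an algorithm has read-only access to the stream, which it scans sequentially in each pass; a workspace ("clean space") initialized to all zeros; and a catalytic memory initially containing an arbitrary string $z$. The algorithm may read and modify the catalytic memory during the computation but must restore it to exactly $z$ at the end. It computes a function $g$ if for every stream $\mathcal S$ and every initial catalytic content $z$ it outputs $g(\mathcal S)$ and terminates with catalytic content exactly $z$. Clean space is the size of the workspace and catalytic space is the total amount of catalytic memory; space is measured in bits. Space complexity refers to storage space (memory maintained between arrivals of consecutive stream items), not to the temporary memory used while processing a single item. -}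

module Defs where

open import Data.Bool.Base using (Bool; false)
open import Data.Fin.Base using (Fin)
import Data.Fin.Properties as Fin
open import Data.Nat.Base using (ℕ; _*_; _≤_)
open import Data.Nat.GeneralisedArithmetic using (iterate)
open import Data.Nat.Properties using (_≟_)
open import Data.Product.Base using (_×_; ∃-syntax)
open import Data.Vec.Base using (Vec; allFin; count; foldl′; replicate)
open import Relation.Binary.PropositionalEquality.Core using (_≡_)
open import Relation.Nullary.Decidable using (¬?)

-- Insertion-only streams of length m; the universe {1,…,n} is Fin n.
Stream : ℕ → ℕ → Set
Stream n m = Vec (Fin n) m

frequency : ∀ {n m} → Stream n m → Fin n → ℕ
frequency S i = count (i Fin.≟_) S

F₀ : ∀ {n m} → Stream n m → ℕ
F₀ {n} S = count (λ i → ¬? (frequency S i ≟ 0)) (allFin n)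

-- Everything that is stored between two consecutive stream items:
-- s bits of clean space and c bits of catalytic space.
record Memory (s c : ℕ) : Set where
  constructor ⟨_,_⟩
  field
    workspace : Vec Bool s
    catalytic : Vec Bool c

open Memory public

-- Only storage is charged, so the processing of an item, and the processing
-- at either end of a pass, is an arbitrary function on memory contents.  None
-- of these functions is told the position in the stream or the number of the
-- pass: an algorithm that needs them has to keep them in its memory.
record CatalyticAlgorithm (n s c : ℕ) : Set where
  field
    startPass : Memory s c → Memory s c
    step      : Memory s c → Fin n → Memory s c
    endPass   : Memory s c → Memory s c
    output    : Memory s c → ℕ

  runPass : ∀ {m} → Stream n m → Memory s c → Memory s c
  runPass S μ = endPass (foldl′ step (startPass μ) S)

  -- The memory after p passes over S, with initial catalytic content z.
  run : ∀ {m} → ℕ → Stream n m → Vec Bool c → Memory s c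
  run p S z = iterate (runPass S) ⟨ replicate s false , z ⟩ p

open CatalyticAlgorithm public

-- A computes g in p passes on all streams of length m.
Computes : ∀ {n s c} → CatalyticAlgorithm n s c → (p m : ℕ) →
           (Stream n m → ℕ) → Set
Computes {n} {c = c} A p m g =
  (S : Stream n m) (z : Vec Bool c) →
  output A (run A p S z) ≡ g S × catalytic (run A p S z) ≡ z

-- f = O(g) as m → ∞, uniformly in n ≤ m.
_∈O_ : (f g : ℕ → ℕ → ℕ) → Set
f ∈O g = ∃[ C ] ∃[ N ] (∀ n m → n ≤ m → N ≤ m → f n m ≤ C * g n m)

{-# OPTIONS --safe #-}

-- For a table T of M cells over ℤ/q, kept in catalytic memory for an item i,
-- rotate T at every arrival of i, increment the first cell at the end of the
-- pass, and rotate backwards in the next pass.  This increments the cell f_i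
-- mod M of T, so the sum over all items of the first cells grows by
-- Z = |{i : M ∣ f_i}| modulo q.  Two further passes undo the increment.
--
-- The choice M = m + 1, q > n would give the number z of absent items at once,
-- but needs m n log n bits.  Instead use levels t ≤ L with q_t = 2^(2^t),
-- M_0 = m + 1 and M_{t+1} = ⌊m / q_t⌋ + 1.  Then Z_t = z + E_t, and since an
-- item counted by E_t occurs at least M_t times, E_t M_t ≤ m; hence E_0 = 0 and
-- E_{t+1} < q_t.  So z mod q_t determines E_{t+1} from Z_{t+1} mod q_t, and then
-- z mod q_{t+1}.  At the last level q_L > m ≥ z.  The cells take
-- Σ_t M_t 2^t = O(m) bits per item, and the residues of all the Z_t together
-- take Σ_t 2^t = O(log m) bits.
module Submission where

open import Defs
open import Data.Bool.Base using (Bool; true; false; if_then_else_)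
open import Data.Fin.Base using (Fin; zero; suc; toℕ)
open import Data.Fin.Patterns using (0F; 1F; 2F; 3F)
import Data.Fin.Properties as Fin
open import Data.Fin.Properties
  using (toℕ-injective; toℕ-fromℕ<; toℕ<n; 2↔Bool; *↔×)
open import Data.Nat.Base
open import Data.Nat.Divisibility using (_∣_; m∣m*n)
open import Data.Nat.DivMod
open import Data.Nat.GeneralisedArithmetic using (fold; iterate; iterate-is-fold)
open import Data.Nat.Logarithm using (⌊log₂_⌋; ⌊log₂⌋-mono-≤; ⌊log₂[2^n]⌋≡n)
open import Data.Nat.Properties
open import Data.Nat.Tactic.RingSolver using (solve-∀)
open import Data.Product.Base using (_×_; _,_; Σ-syntax; ∃-syntax; proj₁; proj₂)
open import Data.Product.Function.NonDependent.Propositional using (_×-↔_)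
open import Data.Sum.Base using (inj₁; inj₂)
open import Data.Vec.Base
  using (Vec; []; _∷_; _++_; count; foldl′; lookup; map; replicate;
         splitAt; tabulate; updateAt)
open import Data.Vec.Properties
  using (++-injective; lookup-map; lookup∘tabulate; lookup∘updateAt;
         lookup∘updateAt′; tabulate-cong; tabulate∘lookup; updateAt-id-local;
         updateAt-updateAt)
open import Function.Base using (id; _∘_)
open import Function.Bundles using (_↔_; mk↔ₛ′; Inverse)
open import Function.Properties.Inverse using (↔-sym; ↔-trans)
open import Relation.Binary.PropositionalEquality
open import Relation.Nullary.Decidable using (Dec; does; yes; no; ¬?)
open import Relation.Nullary.Negation using (contradiction)
open import Relation.Unary using (Pred; Decidable)

open import Algebra.Properties.CommutativeMonoid.Sum +-0-commutativeMonoid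
  using (sum; ∑-distrib-+; sum-cong-≗; sum-replicate-zero)

private
  variable
    A B : Set
    n m : ℕ

indicator : {P : Set} → Dec P → ℕ
indicator P? = if does P? then 1 else 0

-- Modular arithmetic

%-congˡ-+ : ∀ a b c q .{{_ : NonZero q}} →
            a % q ≡ b % q → (a + c) % q ≡ (b + c) % q
%-congˡ-+ a b c q eq = begin
  (a + c) % q            ≡⟨ %-distribˡ-+ a c q ⟩
  (a % q + c % q) % q    ≡⟨ cong (λ x → (x + c % q) % q) eq ⟩
  (b % q + c % q) % q    ≡⟨ %-distribˡ-+ b c q ⟨
  (b + c) % q            ∎
  where open ≡-Reasoning

%-cong-+ : ∀ {a b c d} q .{{_ : NonZero q}} →
           a % q ≡ b % q → c % q ≡ d % q → (a + c) % q ≡ (b + d) % q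
%-cong-+ {a} {b} {c} {d} q eq eq′ = begin
  (a + c) % q    ≡⟨ %-congˡ-+ a b c q eq ⟩
  (b + c) % q    ≡⟨ %-congˡ (+-comm b c) ⟩
  (c + b) % q    ≡⟨ %-congˡ-+ c d b q eq′ ⟩
  (d + b) % q    ≡⟨ %-congˡ (+-comm d b) ⟩
  (b + d) % q    ∎
  where open ≡-Reasoning

[m%q+n]%q≡[m+n]%q : ∀ m n q .{{_ : NonZero q}} → (m % q + n) % q ≡ (m + n) % q
[m%q+n]%q≡[m+n]%q m n q = %-congˡ-+ (m % q) m n q (m%n%n≡m%n m q)

sum-cong-% : ∀ {n} q .{{_ : NonZero q}} {u v : Fin n → ℕ} →
             (∀ j → u j % q ≡ v j % q) → sum u % q ≡ sum v % q
sum-cong-% {zero}  q eq = refl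
sum-cong-% {suc n} q eq = %-cong-+ q (eq zero) (sum-cong-% q (eq ∘ suc))

-- - b is represented by (q - 1) b, avoiding truncated subtraction.
minus : ∀ q .{{_ : NonZero q}} → ℕ → ℕ → ℕ
minus q a b = (a + pred q * b) % q

-- Multiplying `b` by `pred q` turns it into `pred q * x` modulo `q`, and `x + pred q * x` is a
-- multiple of `q`, so only `y` survives.
minus-% : ∀ q .{{_ : NonZero q}} {a b x y} →
          a % q ≡ (x + y) % q → b % q ≡ x % q → minus q a b ≡ y % q
minus-% q@(suc p) {a} {b} {x} {y} eq eq′ = begin
  (a + p * b) % q      ≡⟨ %-cong-+ {a} {x + y} q eq p*b≡p*x ⟩
  (x + y + p * x) % q  ≡⟨ %-congˡ (rearrange x y p) ⟩
  (y + x * q) % q      ≡⟨ [m+kn]%n≡m%n y x q ⟩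
  y % q                ∎
  where
  open ≡-Reasoning
  rearrange : ∀ x y p → x + y + p * x ≡ y + x * suc p
  rearrange = solve-∀
  p*b≡p*x : (p * b) % q ≡ (p * x) % q
  p*b≡p*x = begin
    (p * b) % q              ≡⟨ %-distribˡ-* p b q ⟩
    ((p % q) * (b % q)) % q  ≡⟨ cong (λ r → ((p % q) * r) % q) eq′ ⟩
    ((p % q) * (x % q)) % q  ≡⟨ %-distribˡ-* p x q ⟨
    (p * x) % q              ∎

toℕ-mod : ∀ a q .{{_ : NonZero q}} → toℕ (a mod q) ≡ a % q
toℕ-mod a q = toℕ-fromℕ< (m%n<n a q)

next prev : ∀ {q} .{{_ : NonZero q}} → Fin q → Fin q
next {q} x = suc (toℕ x) mod q
prev {q} x = (toℕ x + pred q) mod q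

prev-next : ∀ {q} .{{_ : NonZero q}} (x : Fin q) → prev (next x) ≡ x
prev-next {q@(suc p)} x = toℕ-injective (begin
  toℕ (prev (next x))             ≡⟨ toℕ-mod (toℕ (next x) + p) q ⟩
  (toℕ (next x) + p) % q          ≡⟨ cong (λ y → (y + p) % q) (toℕ-mod (suc (toℕ x)) q) ⟩
  (suc (toℕ x) % q + p) % q       ≡⟨ [m%q+n]%q≡[m+n]%q (suc (toℕ x)) p q ⟩
  (suc (toℕ x) + p) % q           ≡⟨ %-congˡ (sym (+-suc (toℕ x) p)) ⟩
  (toℕ x + q) % q                 ≡⟨ [m+n]%n≡m%n (toℕ x) q ⟩
  toℕ x % q                       ≡⟨ m<n⇒m%n≡m (toℕ<n x) ⟩
  toℕ x                           ∎)
  where open ≡-Reasoning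

next-prev : ∀ {q} .{{_ : NonZero q}} (x : Fin q) → next (prev x) ≡ x
next-prev {q@(suc p)} x = toℕ-injective (begin
  toℕ (next (prev x))             ≡⟨ toℕ-mod (suc (toℕ (prev x))) q ⟩
  suc (toℕ (prev x)) % q          ≡⟨ cong (λ y → suc y % q) (toℕ-mod (toℕ x + p) q) ⟩
  suc ((toℕ x + p) % q) % q       ≡⟨ %-congˡ (+-comm 1 ((toℕ x + p) % q)) ⟩
  ((toℕ x + p) % q + 1) % q       ≡⟨ [m%q+n]%q≡[m+n]%q (toℕ x + p) 1 q ⟩
  (toℕ x + p + 1) % q             ≡⟨ %-congˡ (trans (+-comm _ 1) (sym (+-suc (toℕ x) p))) ⟩
  (toℕ x + q) % q                 ≡⟨ [m+n]%n≡m%n (toℕ x) q ⟩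
  toℕ x % q                       ≡⟨ m<n⇒m%n≡m (toℕ<n x) ⟩
  toℕ x                           ∎)
  where open ≡-Reasoning

-- Rotating tables

lookup-ext : {xs ys : Vec A n} → (∀ j → lookup xs j ≡ lookup ys j) → xs ≡ ys
lookup-ext {xs = xs} {ys} eq =
  trans (sym (tabulate∘lookup xs)) (trans (tabulate-cong eq) (tabulate∘lookup ys))

-- Reading through `next` shifts the cells down by one: after `f` rotations the first cell is the
-- one that stood at index `f` modulo `M`.
rotate unrotate : ∀ {M} .{{_ : NonZero M}} → Vec A M → Vec A M
rotate   T = tabulate (lookup T ∘ next)
unrotate T = tabulate (lookup T ∘ prev)

unrotate-updateAt-rotate :
  ∀ {M} .{{_ : NonZero M}} (T : Vec A M) y (g : A → A) →
  unrotate (updateAt (rotate T) y g) ≡ updateAt T (next y) g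
unrotate-updateAt-rotate T y g = lookup-ext λ j →
  trans (lookup∘tabulate _ j) (cell j)
  where
  cell : ∀ j → lookup (updateAt (rotate T) y g) (prev j) ≡
               lookup (updateAt T (next y) g) j
  cell j with j Fin.≟ next y
  ... | yes refl = begin
    lookup (updateAt (rotate T) y g) (prev (next y))
      ≡⟨ cong (lookup (updateAt (rotate T) y g)) (prev-next y) ⟩
    lookup (updateAt (rotate T) y g) y
      ≡⟨ lookup∘updateAt y (rotate T) ⟩
    g (lookup (rotate T) y)
      ≡⟨ cong g (lookup∘tabulate _ y) ⟩
    g (lookup T (next y))
      ≡⟨ lookup∘updateAt (next y) T ⟨
    lookup (updateAt T (next y) g) (next y) ∎
    where open ≡-Reasoning
  ... | no j≢ = begin
    lookup (updateAt (rotate T) y g) (prev j)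
      ≡⟨ lookup∘updateAt′ (prev j) y
           (λ eq → j≢ (trans (sym (next-prev j)) (cong next eq))) (rotate T) ⟩
    lookup (rotate T) (prev j)
      ≡⟨ lookup∘tabulate _ (prev j) ⟩
    lookup T (next (prev j))
      ≡⟨ cong (lookup T) (next-prev j) ⟩
    lookup T j
      ≡⟨ lookup∘updateAt′ j (next y) j≢ T ⟨
    lookup (updateAt T (next y) g) j ∎
    where open ≡-Reasoning

-- The residue of `f` modulo `suc b`, built by iterating `next` so that it follows the rotations one
-- at a time.
position : ∀ b → ℕ → Fin (suc b)
position b f = fold zero next f

-- On `suc f`, `iterate` exposes the innermost rotation and `fold` the outermost back rotation. The
-- induction hypothesis at `rotate T` therefore leaves a single conjugation by a rotation.
unrotate-bump-rotate :
  ∀ {b} (g : A → A) f (T : Vec A (suc b)) →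
  fold (updateAt (iterate rotate T f) zero g) unrotate f ≡
  updateAt T (position b f) g
unrotate-bump-rotate g zero    T = refl
unrotate-bump-rotate g (suc f) T =
  trans (cong unrotate (unrotate-bump-rotate g f (rotate T)))
        (unrotate-updateAt-rotate T (position _ f) g)

toℕ-position : ∀ b {f} → f < suc b → toℕ (position b f) ≡ f
toℕ-position b {zero}  f<M = refl
toℕ-position b {suc f} f<M = begin
  toℕ (next (position b f))        ≡⟨ toℕ-mod (suc (toℕ (position b f))) (suc b) ⟩
  suc (toℕ (position b f)) % suc b ≡⟨ cong (λ x → suc x % suc b) (toℕ-position b (<-trans (n<1+n f) f<M)) ⟩
  suc f % suc b                    ≡⟨ m<n⇒m%n≡m f<M ⟩
  suc f                            ∎
  where open ≡-Reasoning

-- Passes over one table per item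

pass : (A → A) → Stream n m → Vec A n → Vec A n
pass g S X = foldl′ (λ X i → updateAt X i g) X S

lookup-pass : (g : A → A) (S : Stream n m) (X : Vec A n) (j : Fin n) →
              lookup (pass g S X) j ≡ iterate g (lookup X j) (frequency S j)
lookup-pass g []      X j = refl
lookup-pass g (i ∷ S) X j with j Fin.≟ i
... | yes refl = trans (lookup-pass g S (updateAt X i g) i)
                       (cong (λ x → iterate g x (frequency S i)) (lookup∘updateAt i X))
... | no j≢i   = trans (lookup-pass g S (updateAt X i g) j)
                       (cong (λ x → iterate g x (frequency S j)) (lookup∘updateAt′ j i j≢i X))

bump : ∀ {b} → (A → A) → Vec (Vec A (suc b)) n → Vec (Vec A (suc b)) n
bump g = map (λ T → updateAt T zero g)

probe : ∀ {b} → (A → A) → Stream n m → Vec (Vec A (suc b)) n → Vec (Vec A (suc b)) n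
probe g S X = pass unrotate S (bump g (pass rotate S X))

lookup-probe : ∀ {b} (g : A → A) (S : Stream n m) (X : Vec (Vec A (suc b)) n) j →
               lookup (probe g S X) j ≡
               updateAt (lookup X j) (position b (frequency S j)) g
lookup-probe g S X j = begin
  lookup (probe g S X) j
    ≡⟨ lookup-pass unrotate S (bump g (pass rotate S X)) j ⟩
  iterate unrotate (lookup (bump g (pass rotate S X)) j) f
    ≡⟨ cong (λ T → iterate unrotate T f) (lookup-map j _ (pass rotate S X)) ⟩
  iterate unrotate (updateAt (lookup (pass rotate S X) j) zero g) f
    ≡⟨ cong (λ T → iterate unrotate (updateAt T zero g) f) (lookup-pass rotate S X j) ⟩
  iterate unrotate (updateAt (iterate rotate (lookup X j) f) zero g) f
    ≡⟨ iterate-is-fold _ unrotate f ⟨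
  fold (updateAt (iterate rotate (lookup X j) f) zero g) unrotate f
    ≡⟨ unrotate-bump-rotate g f (lookup X j) ⟩
  updateAt (lookup X j) (position _ f) g ∎
  where
  open ≡-Reasoning
  f = frequency S j

-- The cell that a probe touches depends on the stream alone, not on the contents, so the second
-- probe meets exactly the cells changed by the first.
probe-inverse : ∀ {b} {g h : A → A} → (∀ x → g (h x) ≡ x) →
                (S : Stream n m) (X : Vec (Vec A (suc b)) n) →
                probe g S (probe h S X) ≡ X
probe-inverse {g = g} {h} gh S X = lookup-ext λ j →
  let p = position _ (frequency S j) in begin
  lookup (probe g S (probe h S X)) j       ≡⟨ lookup-probe g S (probe h S X) j ⟩
  updateAt (lookup (probe h S X) j) p g    ≡⟨ cong (λ T → updateAt T p g) (lookup-probe h S X j) ⟩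
  updateAt (updateAt (lookup X j) p h) p g ≡⟨ updateAt-updateAt p (lookup X j) ⟩
  updateAt (lookup X j) p (g ∘ h)          ≡⟨ updateAt-id-local p (lookup X j) (gh _) ⟩
  lookup X j                               ∎
  where open ≡-Reasoning

headSum : ∀ {b q} → Vec (Vec (Fin q) (suc b)) n → ℕ
headSum X = sum (λ j → toℕ (lookup (lookup X j) zero))

-- The indicator of `suc b ∣ f`. It is 1 at `f = 0`, so absent items always count.
hit : ℕ → ℕ → ℕ
hit b f = indicator (position b f Fin.≟ zero)

hits : ℕ → Stream n m → ℕ
hits b S = sum (λ j → hit b (frequency S j))

-- Only a congruence, because a cell holding `q - 1` wraps around to 0.
headSum-probe : ∀ {b q} .{{_ : NonZero q}} (S : Stream n m)
                (X : Vec (Vec (Fin q) (suc b)) n) →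
                headSum (probe next S X) % q ≡ (headSum X + hits b S) % q
headSum-probe {b = b} {q} S X = trans
  (sum-cong-% q λ j → trans
    (%-congˡ (cong (λ T → toℕ (lookup T zero)) (lookup-probe next S X j)))
    (cell (lookup X j) (position b (frequency S j))))
  (%-congˡ (∑-distrib-+ (λ j → toℕ (lookup (lookup X j) zero)) _))
  where
  cell : ∀ (T : Vec (Fin q) (suc b)) p →
         toℕ (lookup (updateAt T p next) zero) % q ≡
         (toℕ (lookup T zero) + indicator (p Fin.≟ zero)) % q
  cell (x ∷ T) zero    = begin
    toℕ (next x) % q          ≡⟨ %-congˡ (toℕ-mod (suc (toℕ x)) q) ⟩
    suc (toℕ x) % q % q       ≡⟨ m%n%n≡m%n (suc (toℕ x)) q ⟩
    suc (toℕ x) % q           ≡⟨ %-congˡ (+-comm 1 (toℕ x)) ⟩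
    (toℕ x + 1) % q           ∎
    where open ≡-Reasoning
  cell (x ∷ T) (suc p) = %-congˡ (sym (+-identityʳ (toℕ x)))

-- Counting absent items

absent : Stream n m → ℕ
absent S = sum (λ j → indicator (frequency S j ≟ 0))

-- `allFin n` is `tabulate id`; a general `h` is needed because the induction passes to `h ∘ suc`.
count-∁ : {P : Pred A _} (P? : Decidable P) (h : Fin n → A) →
          count (¬? ∘ P?) (tabulate h) + sum (λ j → indicator (P? (h j))) ≡ n
count-∁ {n = zero}  P? h = refl
count-∁ {n = suc n} P? h with does (P? (h zero))
... | true  = trans (+-suc _ _) (cong suc (count-∁ P? (h ∘ suc)))
... | false = cong suc (count-∁ P? (h ∘ suc))

F₀+absent : (S : Stream n m) → F₀ S + absent S ≡ n
F₀+absent S = count-∁ (λ j → frequency S j ≟ 0) id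

sum-indicator-≟ : (x : Fin n) → sum (λ j → indicator (j Fin.≟ x)) ≡ 1
sum-indicator-≟ {suc n} zero    = cong suc (sum-replicate-zero n)
sum-indicator-≟ {suc n} (suc x) = sum-indicator-≟ x

sum-frequency : (S : Stream n m) → sum (frequency S) ≡ m
sum-frequency {n} []      = sum-replicate-zero n
sum-frequency     (x ∷ S) = begin
  sum (frequency (x ∷ S))
    ≡⟨ sum-cong-≗ frequency-∷ ⟩
  sum (λ j → indicator (j Fin.≟ x) + frequency S j)
    ≡⟨ ∑-distrib-+ (λ j → indicator (j Fin.≟ x)) (frequency S) ⟩
  sum (λ j → indicator (j Fin.≟ x)) + sum (frequency S)
    ≡⟨ cong₂ _+_ (sum-indicator-≟ x) (sum-frequency S) ⟩
  suc _ ∎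
  where
  open ≡-Reasoning
  frequency-∷ : ∀ j → frequency (x ∷ S) j ≡ indicator (j Fin.≟ x) + frequency S j
  frequency-∷ j with does (j Fin.≟ x)
  ... | true  = refl
  ... | false = refl

-- With the hit at `f = 0` removed, the sum `falseHits (b t) S` is the error E_t: the present items
-- whose frequency is a multiple of M_t.
falseHit : ℕ → ℕ → ℕ
falseHit b zero    = 0
falseHit b (suc f) = hit b (suc f)

falseHits : ℕ → Stream n m → ℕ
falseHits b S = sum (λ j → falseHit b (frequency S j))

hits≡absent+falseHits : ∀ b (S : Stream n m) → hits b S ≡ absent S + falseHits b S
hits≡absent+falseHits b S = trans
  (sum-cong-≗ (λ j → split (frequency S j)))
  (∑-distrib-+ (λ j → indicator (frequency S j ≟ 0)) _)
  where
  split : ∀ f → hit b f ≡ indicator (f ≟ 0) + falseHit b f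
  split zero    = refl
  split (suc f) = refl

-- For `0 < f < suc b` the position is `f` itself, hence not `zero`. A false hit thus forces
-- `suc b ≤ f`.
falseHit-bound : ∀ b f → falseHit b f * suc b ≤ f
falseHit-bound b zero    = z≤n
falseHit-bound b (suc f) with position b (suc f) Fin.≟ zero
... | no _   = z≤n
... | yes eq = ≤-trans (≤-reflexive (+-identityʳ (suc b))) (≮⇒≥ λ f<M →
  contradiction (trans (sym (toℕ-position b f<M)) (cong toℕ eq)) λ ())

-- Markov's inequality for the frequencies, whose sum is `m`.
falseHits-bound : ∀ b (S : Stream n m) → falseHits b S * suc b ≤ m
falseHits-bound b S = ≤-trans (bound (frequency S)) (≤-reflexive (sum-frequency S))
  where
  bound : ∀ {n} (f : Fin n → ℕ) → sum (falseHit b ∘ f) * suc b ≤ sum f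
  bound {zero}  f = z≤n
  bound {suc n} f = ≤-trans
    (≤-reflexive (*-distribʳ-+ (suc b) (falseHit b (f zero)) _))
    (+-mono-≤ (falseHit-bound b (f zero)) (bound (f ∘ suc)))


-- Bit representations

++-↔ : ∀ {k l} → (Vec A k × Vec A l) ↔ Vec A (k + l)
++-↔ {A = A} {k} {l} = mk↔ₛ′ join split join-split split-join
  where
  join : Vec A k × Vec A l → Vec A (k + l)
  join (xs , ys) = xs ++ ys
  split : Vec A (k + l) → Vec A k × Vec A l
  split zs = proj₁ (splitAt k zs) , proj₁ (proj₂ (splitAt k zs))
  join-split : ∀ zs → join (split zs) ≡ zs
  join-split zs = sym (proj₂ (proj₂ (splitAt k zs)))
  split-join : ∀ p → split (join p) ≡ p
  split-join (xs , ys) =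
    let eq₁ , eq₂ = ++-injective _ xs (join-split (xs ++ ys))
    in cong₂ _,_ eq₁ eq₂

∷-↔ : ∀ {k} → (A × Vec A k) ↔ Vec A (suc k)
∷-↔ = mk↔ₛ′ (λ (x , xs) → x ∷ xs) (λ { (x ∷ xs) → x , xs })
            (λ { (x ∷ xs) → refl }) (λ { (x , xs) → refl })

_⊗_ : ∀ {k l} → A ↔ Vec Bool k → B ↔ Vec Bool l → (A × B) ↔ Vec Bool (k + l)
α ⊗ β = ↔-trans (α ×-↔ β) ++-↔

-- Bijections are used throughout, since every initial catalytic content must decode to a state and
-- be recoverable from it. This is why cells range over a power of two.
Fin-bits : ∀ k → Fin (2 ^ k) ↔ Vec Bool k
Fin-bits zero    = mk↔ₛ′ (λ _ → []) (λ _ → zero) (λ { [] → refl }) (λ { zero → refl })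
Fin-bits (suc k) = ↔-trans *↔× (↔-trans (2↔Bool ×-↔ Fin-bits k) ∷-↔)

Vec-bits : ∀ {k} n → A ↔ Vec Bool k → Vec A n ↔ Vec Bool (n * k)
Vec-bits zero    α = mk↔ₛ′ (λ _ → []) (λ _ → []) (λ { [] → refl }) (λ { [] → refl })
Vec-bits (suc n) α = ↔-trans (↔-sym ∷-↔) (α ⊗ Vec-bits n α)

-- Families indexed by the levels 0, …, L

infixl 5 _▹_

-- Growing at the end lets `decode` treat the highest level last, after recursing into the lower
-- ones.
data Levels (F : ℕ → Set) : ℕ → Set where
  [_] : F zero → Levels F zero
  _▹_ : ∀ {L} → Levels F L → F (suc L) → Levels F (suc L)

mapᴸ : ∀ {F G : ℕ → Set} → (∀ t → F t → G t) → ∀ {L} → Levels F L → Levels G L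
mapᴸ f [ x ]    = [ f zero x ]
mapᴸ f (xs ▹ x) = mapᴸ f xs ▹ f _ x

zipWithᴸ : ∀ {F G H : ℕ → Set} → (∀ t → F t → G t → H t) →
           ∀ {L} → Levels F L → Levels G L → Levels H L
zipWithᴸ f [ x ]    [ y ]    = [ f zero x y ]
zipWithᴸ f (xs ▹ x) (ys ▹ y) = zipWithᴸ f xs ys ▹ f _ x y

mapᴸ-∘ : ∀ {F G H : ℕ → Set} (g : ∀ t → G t → H t) (f : ∀ t → F t → G t) →
         ∀ {L} (x : Levels F L) → mapᴸ g (mapᴸ f x) ≡ mapᴸ (λ t → g t ∘ f t) x
mapᴸ-∘ g f [ x ]    = refl
mapᴸ-∘ g f (xs ▹ x) = cong (_▹ _) (mapᴸ-∘ g f xs)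

mapᴸ-id : ∀ {F : ℕ → Set} {f : ∀ t → F t → F t} → (∀ t x → f t x ≡ x) →
          ∀ {L} (x : Levels F L) → mapᴸ f x ≡ x
mapᴸ-id eq [ x ]    = cong [_] (eq zero x)
mapᴸ-id eq (xs ▹ x) = cong₂ _▹_ (mapᴸ-id eq xs) (eq _ x)

zipWithᴸ-mapᴸ : ∀ {F G H K : ℕ → Set} (h : ∀ t → G t → H t → K t)
                (f : ∀ t → F t → G t) (g : ∀ t → F t → H t) →
                ∀ {L} (x : Levels F L) →
                zipWithᴸ h (mapᴸ f x) (mapᴸ g x) ≡ mapᴸ (λ t y → h t (f t y) (g t y)) x
zipWithᴸ-mapᴸ h f g [ x ]    = refl
zipWithᴸ-mapᴸ h f g (xs ▹ x) = cong (_▹ _) (zipWithᴸ-mapᴸ h f g xs)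

foldl′-mapᴸ : ∀ {F : ℕ → Set} (f : ∀ t → F t → A → F t) {L}
              (x : Levels F L) (S : Vec A m) →
              foldl′ (λ x i → mapᴸ (λ t y → f t y i) x) x S ≡
              mapᴸ (λ t y → foldl′ (f t) y S) x
foldl′-mapᴸ f x []      = sym (mapᴸ-id (λ _ _ → refl) x)
foldl′-mapᴸ f x (i ∷ S) = trans (foldl′-mapᴸ f _ S) (mapᴸ-∘ _ _ x)

total : (ℕ → ℕ) → ℕ → ℕ
total k zero    = k zero
total k (suc L) = total k L + k (suc L)

Levels-bits : ∀ {F : ℕ → Set} {k : ℕ → ℕ} → (∀ t → F t ↔ Vec Bool (k t)) →
              ∀ L → Levels F L ↔ Vec Bool (total k L)
Levels-bits α zero    = ↔-trans
  (mk↔ₛ′ (λ { [ x ] → x }) [_] (λ _ → refl) (λ { [ x ] → refl })) (α zero)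
Levels-bits α (suc L) = ↔-trans
  (mk↔ₛ′ (λ { (xs ▹ x) → xs , x }) (λ { (xs , x) → xs ▹ x })
         (λ { (xs , x) → refl }) (λ { (xs ▹ x) → refl }))
  (Levels-bits α L ⊗ α (suc L))

-- Decoding residues

-- Opaque, so that t can be inferred from modulus t.
opaque
  modulus : ℕ → ℕ
  modulus t = 2 ^ 2 ^ t

  instance
    modulus≢0 : ∀ {t} → NonZero (modulus t)
    modulus≢0 {t} = m^n≢0 2 (2 ^ t)

  -- Each modulus is the square of the previous one; divisibility allows a residue of one level to
  -- be reduced to the modulus of the level below.
  modulus-∣ : ∀ t → modulus t ∣ modulus (suc t)
  modulus-∣ t = subst (modulus t ∣_)
    (sym (^-distribˡ-+-* 2 (2 ^ t) (2 ^ t + 0))) (m∣m*n (2 ^ (2 ^ t + 0)))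

  residue-bits : ∀ t → Fin (modulus t) ↔ Vec Bool (2 ^ t)
  residue-bits t = Fin-bits (2 ^ t)

Residues : ℕ → Set
Residues = Levels (Fin ∘ modulus)

-- The inner difference is meant to be the error of level `suc t`; the outer one removes it from the
-- residue `r`.
decode : ∀ {L} → Residues L → ℕ
decode [ r ]            = toℕ r
decode (_▹_ {t} rs r) =
  minus (modulus (suc t)) (toℕ r) (minus (modulus t) (toℕ r) (decode rs))

decode-correct :
  ∀ {F : ℕ → Set} {f : ∀ t → F t → Fin (modulus t)} {z} {e : ℕ → ℕ} →
  e 0 ≡ 0 → (∀ t → e (suc t) < modulus t) →
  (∀ t y → toℕ (f t y) ≡ (z + e t) % modulus t) →
  ∀ {L} (x : Levels F L) → decode (mapᴸ f x) ≡ z % modulus L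
decode-correct {z = z} e₀ e< f≡ [ x ] =
  trans (f≡ zero x) (%-congˡ (trans (cong (z +_) e₀) (+-identityʳ z)))
decode-correct {f = f} {z} {e} e₀ e< f≡ (_▹_ {t} xs x) = begin
  minus q′ r (minus q r (decode (mapᴸ f xs)))
    -- The error is known only modulo `q`; the bound `e< t` makes it equal to its residue, so it can
    -- be subtracted modulo the larger `q′`.
    ≡⟨ cong (minus q′ r) (trans error≡ (m<n⇒m%n≡m (e< t))) ⟩
  minus q′ r (e (suc t))
    ≡⟨ minus-% q′ {x = e (suc t)}
         (trans (%-congˡ r≡) (trans (m%n%n≡m%n (z + e (suc t)) q′)
                                    (%-congˡ (+-comm z (e (suc t)))))) refl ⟩
  z % q′ ∎
  where
  open ≡-Reasoning
  q  = modulus t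
  q′ = modulus (suc t)
  r  = toℕ (f (suc t) x)
  r≡ : r ≡ (z + e (suc t)) % q′
  r≡ = f≡ (suc t) x
  error≡ : minus q r (decode (mapᴸ f xs)) ≡ e (suc t) % q
  error≡ = minus-% q {x = z}
    (trans (%-congˡ r≡) (m∣n⇒o%n%m≡o%m q q′ (z + e (suc t)) (modulus-∣ t)))
    (trans (%-congˡ (decode-correct e₀ e< f≡ xs)) (m%n%n≡m%n z q))

-- The algorithm on decoded memories

module Machine (n L : ℕ) (b : ℕ → ℕ) where

  Tables : ℕ → Set
  Tables t = Vec (Vec (Fin (modulus t)) (suc (b t))) n

  -- The `Fin 4` component is the number of the current pass, which the memory itself must hold.
  Work Catalyst State : Set
  Work     = Fin 4 × Residues L
  Catalyst = Levels Tables L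
  State    = Work × Catalyst

  residues : Catalyst → Residues L
  residues = mapᴸ (λ t Y → headSum Y mod modulus t)

  difference : Residues L → Residues L → Residues L
  difference = zipWithᴸ (λ t r s → (toℕ r + pred (modulus t) * toℕ s) mod modulus t)

  turn : Fin 4 → ∀ {M} .{{_ : NonZero M}} → Vec A M → Vec A M
  turn 0F = rotate
  turn 1F = unrotate
  turn 2F = rotate
  turn 3F = unrotate

  start : State → State
  start ((0F , r) , X) = (0F , residues X) , X
  start σ              = σ

  visit : State → Fin n → State
  visit ((p , r) , X) i = (p , r) , mapᴸ (λ t Y → updateAt Y i (turn p)) X

  -- The residues hold the original head sums during the first two passes and the measured
  -- differences from then on. The last two passes repeat the first two with `prev` in place of
  -- `next`.
  finish : State → State
  finish ((0F , r) , X) = (1F , r) , mapᴸ (λ t → bump next) X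
  finish ((1F , r) , X) = (2F , difference (residues X) r) , X
  finish ((2F , r) , X) = (3F , r) , mapᴸ (λ t → bump prev) X
  finish ((3F , r) , X) = (0F , r) , X

  answer : State → ℕ
  answer ((p , r) , X) = n ∸ decode r

  onePass : Stream n m → State → State
  onePass S σ = finish (foldl′ visit (start σ) S)

  fourPasses : Stream n m → State → State
  fourPasses S σ = iterate (onePass S) σ 4

  -- Effect of two and of four passes

  foldl′-visit : ∀ p r X (S : Stream n m) →
                 foldl′ visit ((p , r) , X) S ≡
                 ((p , r) , mapᴸ (λ t → pass (turn p) S) X)
  foldl′-visit p r X S = trans (visits X S)
    (cong ((p , r) ,_) (foldl′-mapᴸ (λ t Y i → updateAt Y i (turn p)) X S))
    where
    visits : ∀ {m} X (S : Stream n m) → foldl′ visit ((p , r) , X) S ≡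
             ((p , r) , foldl′ (λ X i → mapᴸ (λ t Y → updateAt Y i (turn p)) X) X S)
    visits X []      = refl
    visits X (i ∷ S) = visits _ S

  module _ (S : Stream n m) (X : Catalyst) where

    probed : Catalyst
    probed = mapᴸ (λ t → probe next S) X

    measured : Residues L
    measured = difference (residues probed) (residues X)

    twoPasses-probe : ∀ r → onePass S (onePass S ((0F , r) , X)) ≡
                            ((2F , measured) , probed)
    twoPasses-probe r = begin
      onePass S (finish (foldl′ visit ((0F , residues X) , X) S))
        ≡⟨ cong (onePass S ∘ finish) (foldl′-visit 0F _ X S) ⟩
      finish (foldl′ visit ((1F , residues X) , _) S)
        ≡⟨ cong finish (foldl′-visit 1F _ _ S) ⟩
      finish ((1F , residues X) , _)
        ≡⟨ cong (λ Y → finish ((1F , residues X) , Y))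
             -- Fusing the levelwise forward pass, increment and backward pass yields `probe next S`
             -- at every level.
             (trans (cong (mapᴸ _) (mapᴸ-∘ _ _ X)) (mapᴸ-∘ _ _ X)) ⟩
      ((2F , measured) , probed) ∎
      where open ≡-Reasoning

  twoPasses-unprobe : ∀ r (S : Stream n m) X →
    onePass S (onePass S ((2F , r) , X)) ≡ ((0F , r) , mapᴸ (λ t → probe prev S) X)
  twoPasses-unprobe r S X = begin
    onePass S (finish (foldl′ visit ((2F , r) , X) S))
      ≡⟨ cong (onePass S ∘ finish) (foldl′-visit 2F _ X S) ⟩
    finish (foldl′ visit ((3F , r) , _) S)
      ≡⟨ cong finish (foldl′-visit 3F _ _ S) ⟩
    finish ((3F , r) , _)
      ≡⟨ cong (λ Y → finish ((3F , r) , Y))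
           (trans (cong (mapᴸ _) (mapᴸ-∘ _ _ X)) (mapᴸ-∘ _ _ X)) ⟩
    ((0F , r) , mapᴸ (λ t → probe prev S) X) ∎
    where open ≡-Reasoning

  fourPasses-restore : ∀ (S : Stream n m) σ → proj₁ (proj₁ σ) ≡ 0F →
                       fourPasses S σ ≡ ((0F , measured S (proj₂ σ)) , proj₂ σ)
  fourPasses-restore S ((.0F , r) , X) refl = begin
    fourPasses S ((0F , r) , X)
      ≡⟨ cong (onePass S ∘ onePass S) (twoPasses-probe S X r) ⟩
    onePass S (onePass S ((2F , measured S X) , probed S X))
      ≡⟨ twoPasses-unprobe _ S _ ⟩
    ((0F , measured S X) , mapᴸ (λ t → probe prev S) (probed S X))
      ≡⟨ cong ((0F , measured S X) ,_) (trans (mapᴸ-∘ _ _ X)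
           (mapᴸ-id (λ t → probe-inverse prev-next S) X)) ⟩
    ((0F , measured S X) , X) ∎
    where open ≡-Reasoning

  -- Subtracting the head sums from before the probe cancels the unknown catalytic content. The
  -- residues are presented as `mapᴸ f X`, the form that `decode-correct` takes.
  measured≡hits : (S : Stream n m) (X : Catalyst) → Σ[ f ∈ (∀ t → Tables t → Fin (modulus t)) ]
    (measured S X ≡ mapᴸ f X) × (∀ t Y → toℕ (f t Y) ≡ hits (b t) S % modulus t)
  measured≡hits S X = _ , eq , values
    where
    eq = trans (cong (λ rs → difference rs (residues X)) (mapᴸ-∘ _ _ X))
               (zipWithᴸ-mapᴸ _ _ _ X)
    values : ∀ t (Y : Tables t) → _
    values t Y = trans (toℕ-mod _ q) (minus-% q {x = headSum Y}
      (trans (%-congˡ (toℕ-mod _ q))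
        (trans (m%n%n≡m%n (headSum (probe next S Y)) q) (headSum-probe S Y)))
      (trans (%-congˡ (toℕ-mod _ q)) (m%n%n≡m%n (headSum Y) q)))
      where q = modulus t

  answer-correct : n ≤ m → m < modulus L →
                   (∀ (S : Stream n m) → falseHits (b 0) S ≡ 0) →
                   (∀ t (S : Stream n m) → falseHits (b (suc t)) S < modulus t) →
                   ∀ (S : Stream n m) X → n ∸ decode (measured S X) ≡ F₀ S
  answer-correct n≤m m<q none few S X with measured≡hits S X
  ... | f , eq , values = begin
    n ∸ decode (measured S X)       ≡⟨ cong (λ r → n ∸ decode r) eq ⟩
    n ∸ decode (mapᴸ f X)           ≡⟨ cong (n ∸_) (decode-correct
                                            {z = absent S} {e = λ t → falseHits (b t) S}
                                            (none S) (λ t → few t S) (λ t Y → trans (values t Y) (%-congˡ (hits≡absent+falseHits (b t) S))) X) ⟩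
    n ∸ absent S % modulus L          ≡⟨ cong (n ∸_) (m<n⇒m%n≡m absent<q) ⟩
    n ∸ absent S                      ≡⟨ cong (_∸ absent S) (F₀+absent S) ⟨
    F₀ S + absent S ∸ absent S        ≡⟨ m+n∸n≡m (F₀ S) (absent S) ⟩
    F₀ S                              ∎
    where
    open ≡-Reasoning
    absent<q : absent S < modulus L
    absent<q = ≤-<-trans
      (≤-trans (m≤n+m (absent S) (F₀ S)) (≤-reflexive (F₀+absent S)))
      (≤-<-trans n≤m m<q)

  -- Encoding of the states in bits

  cleanBits catalyticBits : ℕ
  cleanBits     = 2 + total (2 ^_) L
  catalyticBits = total (λ t → n * (suc (b t) * 2 ^ t)) L

  work-bits : Work ↔ Vec Bool cleanBits
  work-bits = Fin-bits 2 ⊗ Levels-bits residue-bits L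

  catalyst-bits : Catalyst ↔ Vec Bool catalyticBits
  catalyst-bits = Levels-bits (λ t → Vec-bits n (Vec-bits (suc (b t)) (residue-bits t))) L

  load : Memory cleanBits catalyticBits → State
  load ⟨ w , z ⟩ = Inverse.from work-bits w , Inverse.from catalyst-bits z

  store : State → Memory cleanBits catalyticBits
  store (w , X) = ⟨ Inverse.to work-bits w , Inverse.to catalyst-bits X ⟩

  load-store : ∀ σ → load (store σ) ≡ σ
  load-store (w , X) = cong₂ _,_ (Inverse.strictlyInverseʳ work-bits w)
                                 (Inverse.strictlyInverseʳ catalyst-bits X)

  algorithm : CatalyticAlgorithm n cleanBits catalyticBits
  algorithm = record
    { startPass = store ∘ start ∘ load
    ; step      = λ μ i → store (visit (load μ) i)
    ; endPass   = store ∘ finish ∘ load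
    ; output    = answer ∘ load
    }

  runPass-store : ∀ (S : Stream n m) μ →
                  runPass algorithm S μ ≡ store (onePass S (load μ))
  runPass-store S μ = trans
    (cong (store ∘ finish ∘ load) (steps (start (load μ)) S))
    (cong (store ∘ finish) (load-store (foldl′ visit (start (load μ)) S)))
    where
    steps : ∀ {m} σ (S : Stream n m) →
            foldl′ (step algorithm) (store σ) S ≡ store (foldl′ visit σ S)
    steps σ []      = refl
    steps σ (i ∷ S) = trans
      (cong (λ τ → foldl′ (step algorithm) (store (visit τ i)) S) (load-store σ))
      (steps (visit σ i) S)

  run-store : ∀ p (S : Stream n m) μ → load (iterate (runPass algorithm S) μ p) ≡
                                       iterate (onePass S) (load μ) p
  run-store zero    S μ = refl
  run-store (suc p) S μ = trans (run-store p S (runPass algorithm S μ))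
    (cong (λ σ → iterate (onePass S) σ p)
      (trans (cong load (runPass-store S μ)) (load-store (onePass S (load μ)))))

  firstPass : ∀ z → proj₁ (proj₁ (load ⟨ replicate cleanBits false , z ⟩)) ≡ 0F
  firstPass z = refl

  load-run : ∀ p (S : Stream n m) z → load (run algorithm p S z) ≡
             iterate (onePass S) (load ⟨ replicate cleanBits false , z ⟩) p
  load-run p S z = run-store p S ⟨ replicate cleanBits false , z ⟩

  decodeCatalyst : Vec Bool catalyticBits → Catalyst
  decodeCatalyst = Inverse.from catalyst-bits

  load-run-four : ∀ (S : Stream n m) z → load (run algorithm 4 S z) ≡
                  ((0F , measured S (decodeCatalyst z)) , decodeCatalyst z)
  load-run-four S z = trans (load-run 4 S z) 
    (fourPasses-restore S (load ⟨ replicate cleanBits false , z ⟩) (firstPass z))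

  -- Decoding is injective, being inverted by `to`, so equal tables mean equal bit strings.
  catalytic-load : ∀ μ z → proj₂ (load μ) ≡ decodeCatalyst z → catalytic μ ≡ z
  catalytic-load μ z eq = begin
    catalytic μ                                    ≡⟨ strictlyInverseˡ (catalytic μ) ⟨
    to (proj₂ (load μ))                            ≡⟨ cong to eq ⟩
    to (decodeCatalyst z)                          ≡⟨ strictlyInverseˡ z ⟩
    z                                              ∎
    where
    open ≡-Reasoning
    open Inverse catalyst-bits using (to; strictlyInverseˡ)

  computes : n ≤ m → m < modulus L →
             (∀ (S : Stream n m) → falseHits (b 0) S ≡ 0) →
             (∀ t (S : Stream n m) → falseHits (b (suc t)) S < modulus t) →
             Computes algorithm 4 m F₀
  computes n≤m m<q none few S z = conclude (run algorithm 4 S z) (load-run-four S z)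
    where
    conclude : ∀ μ → load μ ≡ ((0F , measured S (decodeCatalyst z)) , decodeCatalyst z) →
               output algorithm μ ≡ F₀ S × catalytic μ ≡ z
    conclude μ eq =
        trans (cong answer eq) (answer-correct n≤m m<q none few S (decodeCatalyst z))
      , catalytic-load μ z (cong proj₂ eq)

-- Choice of the parameters

-- This is M_t less one, as a table of level `t` has `suc (lastIndex m t)` cells.
lastIndex : ℕ → ℕ → ℕ
lastIndex m zero    = m
lastIndex m (suc t) = m / modulus t

falseHits-zero : (S : Stream n m) → falseHits m S ≡ 0
falseHits-zero {m = m} S = n<1⇒n≡0 (*-cancelʳ-< (suc m) (falseHits m S) 1
  (≤-<-trans (falseHits-bound m S) (≤-reflexive (sym (+-identityʳ (suc m))))))

-- The table size exceeds `m / modulus t`, so `modulus t` false hits would require more than `m`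
-- arrivals.
falseHits-suc : ∀ t (S : Stream n m) → falseHits (lastIndex m (suc t)) S < modulus t
falseHits-suc {m = m} t S = *-cancelʳ-< (suc (m / q)) (falseHits (m / q) S) q (begin-strict
  falseHits (m / q) S * suc (m / q) ≤⟨ falseHits-bound (m / q) S ⟩
  m                                 ≡⟨ m≡m%n+[m/n]*n m q ⟩
  m % q + m / q * q                 <⟨ +-monoˡ-< (m / q * q) (m%n<n m q) ⟩
  q + m / q * q                     ≡⟨ *-comm (suc (m / q)) q ⟩
  q * suc (m / q)                   ∎)
  where
  open ≤-Reasoning
  q = modulus t

2^-between : ∀ u → ∃[ l ] (u < 2 ^ l × 2 ^ l ≤ 1 + 2 * u)
2^-between zero    = 0 , ≤-refl , ≤-refl
2^-between (suc u) with 2^-between u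
... | l , u<2^l , 2^l≤ with m≤n⇒m<n∨m≡n u<2^l
...   | inj₁ 1+u<2^l = l , 1+u<2^l , ≤-trans 2^l≤ (s≤s (*-monoʳ-≤ 2 (n≤1+n u)))
-- Here `suc u` has caught up with the power of two, so the exponent moves up by one.
...   | inj₂ 1+u≡2^l = suc l , subst (suc u <_) (cong (2 *_) 1+u≡2^l) (m<m+n (suc u) (s≤s z≤n))
                             , ≤-trans (≤-reflexive (cong (2 *_) (sym 1+u≡2^l))) (n≤1+n _)

-- The last level L has `⌊log₂ m ⌋ < 2 ^ L`, so its modulus exceeds `m`, while `2 ^ L` stays
-- logarithmic in `m`.
levels : ℕ → ℕ
levels m = proj₁ (2^-between ⌊log₂ m ⌋)

-- Otherwise monotonicity of the logarithm would put `suc ⌊log₂ n ⌋` below `⌊log₂ n ⌋`.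
n<2^[1+⌊log₂n⌋] : ∀ n → n < 2 ^ suc ⌊log₂ n ⌋
n<2^[1+⌊log₂n⌋] n = ≰⇒> λ 2^≤n → 1+n≰n
  (subst (_≤ ⌊log₂ n ⌋) (⌊log₂[2^n]⌋≡n (suc ⌊log₂ n ⌋)) (⌊log₂⌋-mono-≤ 2^≤n))

opaque
  unfolding modulus

  m<modulus-levels : ∀ m → m < modulus (levels m)
  m<modulus-levels m = <-≤-trans (n<2^[1+⌊log₂n⌋] m)
    (^-monoʳ-≤ 2 (proj₁ (proj₂ (2^-between ⌊log₂ m ⌋))))

-- Bounds on the space

1+n≤2^n : ∀ n → suc n ≤ 2 ^ n
1+n≤2^n zero    = ≤-refl
1+n≤2^n (suc n) = +-mono-≤ (m^n>0 2 n) (≤-trans (1+n≤2^n n) (m≤m+n _ 0))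

⌊log₂n⌋≤n : ∀ n → ⌊log₂ n ⌋ ≤ n
⌊log₂n⌋≤n n = ≤-trans (⌊log₂⌋-mono-≤ (≤-trans (n≤1+n n) (1+n≤2^n n))) (≤-reflexive (⌊log₂[2^n]⌋≡n n))

total-2^ : ∀ L → total (2 ^_) L ≤ 2 ^ suc L
total-2^ zero    = s≤s z≤n
total-2^ (suc L) = ≤-trans (+-monoˡ-≤ (2 ^ suc L) (total-2^ L))
                           (+-monoʳ-≤ (2 ^ suc L) (m≤m+n _ 0))

total-*ˡ : ∀ c k L → total (λ t → c * k t) L ≡ c * total k L
total-*ˡ c k zero    = refl
total-*ˡ c k (suc L) = trans (cong (_+ c * k (suc L)) (total-*ˡ c k L))
                             (sym (*-distribˡ-+ c (total k L) (k (suc L))))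

2n≤2^n : ∀ n → 2 * n ≤ 2 ^ n
2n≤2^n zero    = z≤n
2n≤2^n (suc n) = *-monoʳ-≤ 2 (1+n≤2^n n)

opaque
  unfolding modulus

  -- Of the two factors `2 ^ t`, one will absorb the cell width and the other gives the geometric
  -- decay in `lastIndex-bound`.
  4^≤modulus : ∀ t → 2 ^ t * 2 ^ t ≤ modulus t
  4^≤modulus t = begin
    2 ^ t * 2 ^ t    ≡⟨ ^-distribˡ-+-* 2 t t ⟨
    2 ^ (t + t)      ≤⟨ ^-monoʳ-≤ 2 (≤-trans (≤-reflexive (cong (t +_) (sym (+-identityʳ t)))) (2n≤2^n t)) ⟩
    2 ^ 2 ^ t        ∎
    where open ≤-Reasoning

_/2^_ : ℕ → ℕ → ℕ
m /2^ t = _/_ m (2 ^ t) {{m^n≢0 2 t}}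

-- The sum of the bounds m / 2^t telescopes because consecutive terms at least halve.
halving : ∀ m t → 2 * (m /2^ suc t) ≤ m /2^ t
halving m t = begin
  2 * (m /2^ suc t)                 ≡⟨ *-comm 2 (m /2^ suc t) ⟩
  (m /2^ suc t) * 2             ≡⟨ cong (_* 2) (trans
    (/-congʳ {m = m} {{m^n≢0 2 (suc t)}} {{nz}} (*-comm 2 (2 ^ t)))
    (sym (m/n/o≡m/[n*o] m (2 ^ t) 2 {{m^n≢0 2 t}} {{_}} {{nz}}))) ⟩
  (m /2^ t) / 2 * 2                 ≤⟨ m/n*n≤m (m /2^ t) 2 ⟩
  m /2^ t                           ∎
  where
  open ≤-Reasoning
  nz : NonZero (2 ^ t * 2)
  nz = m*n≢0 (2 ^ t) 2 {{m^n≢0 2 t}}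

lastIndex-bound : ∀ m t → lastIndex m (suc t) * 2 ^ t ≤ m /2^ t
lastIndex-bound m t = begin
  m / modulus t * 2 ^ t             ≡⟨ m*n/n≡m _ (2 ^ t) {{p}} ⟨
  _/_ (m / modulus t * 2 ^ t * 2 ^ t) (2 ^ t) {{p}}
    ≤⟨ /-monoˡ-≤ (2 ^ t) {{p}} (begin
         m / modulus t * 2 ^ t * 2 ^ t    ≡⟨ *-assoc (m / modulus t) (2 ^ t) (2 ^ t) ⟩
         m / modulus t * (2 ^ t * 2 ^ t)  ≤⟨ *-monoʳ-≤ (m / modulus t) (4^≤modulus t) ⟩
         m / modulus t * modulus t        ≤⟨ m/n*n≤m m (modulus t) ⟩
         m                                ∎) ⟩
  m /2^ t                           ∎
  where
  open ≤-Reasoning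
  p = m^n≢0 2 t

cellBits : ℕ → ℕ → ℕ
cellBits m t = suc (lastIndex m t) * 2 ^ t

-- The term `4 * (m /2^ L)` is a potential. Level `suc L` costs at most `2 * (m /2^ L)` plus one
-- extra cell of `2 ^ suc L` bits, and by `halving` the potential drops by at least that first
-- amount. The coefficient 5 is 1 for level 0 plus 4 for the initial potential; the extra cells add
-- up to less than `2 ^ suc L`.
total-cellBits : ∀ m L → total (cellBits m) L + 4 * (m /2^ L) ≤ 5 * m + 2 ^ suc L
total-cellBits m zero    = begin
  suc m * 1 + 4 * (m / 1)        ≡⟨ cong (λ d → suc m * 1 + 4 * d) (n/1≡n m) ⟩
  suc m * 1 + 4 * m              ≡⟨ rearrange m ⟩
  5 * m + 1                      ≤⟨ +-monoʳ-≤ (5 * m) (s≤s z≤n) ⟩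
  5 * m + 2                      ∎
  where
  open ≤-Reasoning
  rearrange : ∀ m → suc m * 1 + 4 * m ≡ 5 * m + 1
  rearrange = solve-∀
total-cellBits m (suc L) = begin
  c + suc i * (2 * p) + 4 * d′
    ≡⟨ rearrange c i p d′ ⟩
  c + 2 * (i * p) + 2 * (2 * d′) + 2 * p
    ≤⟨ +-monoˡ-≤ (2 * p) (+-mono-≤ (+-monoʳ-≤ c (*-monoʳ-≤ 2 (lastIndex-bound m L)))
                                     (*-monoʳ-≤ 2 (halving m L))) ⟩
  c + 2 * d + 2 * d + 2 * p
    ≡⟨ cong (_+ 2 * p) (collect c d) ⟩
  c + 4 * d + 2 * p
    ≤⟨ +-monoˡ-≤ (2 * p) (total-cellBits m L) ⟩
  5 * m + 2 * p + 2 * p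
    ≡⟨ double m p ⟩
  5 * m + 2 * (2 * p) ∎
  where
  open ≤-Reasoning
  c  = total (cellBits m) L
  i  = lastIndex m (suc L)
  p  = 2 ^ L
  d  = m /2^ L
  d′ = m /2^ suc L
  rearrange : ∀ c i p d → c + suc i * (2 * p) + 4 * d ≡ c + 2 * (i * p) + 2 * (2 * d) + 2 * p
  rearrange = solve-∀
  collect : ∀ c d → c + 2 * d + 2 * d ≡ c + 4 * d
  collect = solve-∀
  double : ∀ m p → 5 * m + 2 * p + 2 * p ≡ 5 * m + 2 * (2 * p)
  double = solve-∀

2^[1+levels]≤ : ∀ m → 2 ^ suc (levels m) ≤ 2 + 4 * ⌊log₂ m ⌋
2^[1+levels]≤ m = begin
  2 * 2 ^ levels m           ≤⟨ *-monoʳ-≤ 2 (proj₂ (proj₂ (2^-between ⌊log₂ m ⌋))) ⟩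
  2 * (1 + 2 * ⌊log₂ m ⌋)    ≡⟨ rearrange ⌊log₂ m ⌋ ⟩
  2 + 4 * ⌊log₂ m ⌋          ∎
  where
  open ≤-Reasoning
  rearrange : ∀ u → 2 * (1 + 2 * u) ≡ 2 + 4 * u
  rearrange = solve-∀

module _ (n m : ℕ) where
  open Machine n (levels m) (lastIndex m) public
    using () renaming (algorithm to F₀-algorithm; cleanBits to F₀-clean;
                       catalyticBits to F₀-catalytic; computes to F₀-computes)

F₀-clean-bound : F₀-clean ∈O (λ n m → ⌊log₂ m ⌋)
-- For `2 ≤ m` the logarithm is at least 1, so the additive constant 4 is absorbed by another
-- `4 * u`.
F₀-clean-bound = 8 , 2 , λ n m _ 2≤m → let u = ⌊log₂ m ⌋ in begin
  2 + total (2 ^_) (levels m)   ≤⟨ +-monoʳ-≤ 2 (≤-trans (total-2^ (levels m)) (2^[1+levels]≤ m)) ⟩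
  4 * 1 + 4 * u                 ≤⟨ +-monoˡ-≤ (4 * u) (*-monoʳ-≤ 4 (⌊log₂⌋-mono-≤ 2≤m)) ⟩
  4 * u + 4 * u                 ≡⟨ *-distribʳ-+ u 4 4 ⟨
  8 * u                         ∎
  where open ≤-Reasoning

F₀-catalytic-bound : F₀-catalytic ∈O (λ n m → m * n)
-- The constant is 5 + 2 + 4, with `1 ≤ m` absorbing the additive 2 and `⌊log₂ m ⌋ ≤ m` the term
-- with coefficient 4.
F₀-catalytic-bound = 11 , 1 , λ n m _ 1≤m → let L = levels m in begin
  total (λ t → n * cellBits m t) L     ≡⟨ total-*ˡ n (cellBits m) L ⟩
  n * total (cellBits m) L             ≤⟨ *-monoʳ-≤ n (begin
    total (cellBits m) L                   ≤⟨ m≤m+n _ _ ⟩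
    total (cellBits m) L + 4 * (m /2^ L)   ≤⟨ total-cellBits m L ⟩
    5 * m + 2 ^ suc L                      ≤⟨ +-monoʳ-≤ (5 * m) (2^[1+levels]≤ m) ⟩
    5 * m + (2 * 1 + 4 * ⌊log₂ m ⌋)        ≤⟨ +-monoʳ-≤ (5 * m) (+-mono-≤ (*-monoʳ-≤ 2 1≤m) (*-monoʳ-≤ 4 (⌊log₂n⌋≤n m))) ⟩
    5 * m + (2 * m + 4 * m)                ≡⟨ collect m ⟩
    11 * m                                 ∎) ⟩
  n * (11 * m)                         ≡⟨ rearrange n m ⟩
  11 * (m * n)                         ∎
  where
  open ≤-Reasoning
  collect : ∀ m → 5 * m + (2 * m + 4 * m) ≡ 11 * m
  collect = solve-∀
  rearrange : ∀ n m → n * (11 * m) ≡ 11 * (m * n)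
  rearrange = solve-∀

theorem6 : Σ[ clean ∈ (ℕ → ℕ → ℕ) ]
    Σ[ cat ∈ (ℕ → ℕ → ℕ) ]
    Σ[ A ∈ ((n m : ℕ) → CatalyticAlgorithm n (clean n m) (cat n m)) ]
    ((n m : ℕ) → n ≤ m → Computes (A n m) 4 m F₀)
    × (clean ∈O (λ n m → ⌊log₂ m ⌋))
    × (cat ∈O (λ n m → m * n))
theorem6 =
    F₀-clean , F₀-catalytic , F₀-algorithm
  , (λ n m n≤m → F₀-computes n m n≤m (m<modulus-levels m) falseHits-zero falseHits-suc)
  , F₀-clean-bound
  , F₀-catalytic-bound
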